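{- Work in permissive-nominal algebra with permission sets taken from $\mathcal P$, the set of all sets of atoms of the form $(\mathbb A^<\setminus A)\cup B$ with $A\subseteq\mathbb A^<$ and $B\subseteq\mathbb A^>$ finite. There exist a theory $\mathsf T$ and an assertion $r'=s'$ in the language of $\mathsf T$ such that $\mathsf T\vDash_{fin}r'=s'$ and $\mathsf T\not\vDash r'=s'$ (where models are permissive-nominal sets with permission sets in $\mathcal P$).
   Context: **Atoms and permissive-nominal sets.** For each $i\in\mathbb N$ fix countably infinite sets of atoms $\mathbb A^<_i,\mathbb A^>_i$ (all these sets pairwise disjoint). Write $\mathbb A_i=\mathbb A^<_i\cup\mathbb A^>_i$, $\mathbb A^<=\bigcup_i\mathbb A^<_i$, $\mathbb A^>=\bigcup_i\mathbb A^>_i$, $\mathbb A=\mathbb A^<\cup\mathbb A^>$. A permutation is an element of the group $\mathbb P_{fin}$ of bijections of $\mathbb A$ generated by swappings $(a\ b)$ with $a,b$ in the same $\mathbb A_i$. The permission sets are the elements of $\mathcal P$. A set with a permutation action $\mathsf X$ is a carrier set $|\mathsf X|$ with a group action of $\mathbb P_{fin}$, written $\pi\cdot x$. $A\subseteq\mathbb A$ supports $x\in|\mathsf X|$ when every permutation $\pi$ with $\pi(a)=a$ for all $a\in A$ satisfies $\pi\cdot x=x$. $\mathsf X$ is a permissive-nominal set (with permission sets in $\mathcal P$) when every $x\in|\mathsf X|$ has a unique least supporting set $\mathrm{supp}(x)$ and $\mathrm{supp}(x)\subseteq S$ for some $S\in\mathcal P$. A function $F:|\mathsf X|\to|\mathsf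 Y|$ is equivariant when $F(\pi\cdot x)=\pi\cdot F(x)$ for all $\pi,x$. Atoms have action $\pi\cdot a=\pi(a)$; finite products have the componentwise action. For $a\in\mathbb A_\nu$, $x\in|\mathsf X|$, $[a]x=\{(a,x)\}\cup\{(b,(b\ a)\cdot x)\mid b\in\mathbb A_\nu\setminus\mathrm{supp}(x),\ b\neq a\}$; $[\mathbb A_\nu]\mathsf X$ has carrier $\{[a]x\mid a\in\mathbb A_\nu,x\in|\mathsf X|\}$ and action $\pi\cdot[a]x=[\pi(a)]\pi\cdot x$. **Signatures and terms.** A signature $\Sigma$ consists of: name sorts $\mathcal A\subseteq\mathbb N$ (ranged over by $\nu$) and base sorts $\mathcal B$ (ranged over by $\tau$), giving sorts $\alpha::=\nu\mid\tau\mid(\alpha,\dots,\alpha)\mid[\nu]\alpha$; constants $C$, each with a base sort $\mathrm{sort}(C)$ and a set $\mathrm{pmss}(C)\subseteq\mathbb A^<$; unknowns $X$, each with a sort $\mathrm{sort}(X)$ and a permission set $\mathrm{fa}(X)\in\mathcal P$; term-formers $\mathsf f$, each with an arity $(\alpha)\tau$. Terms: $a:\nu$ for $a\in\mathbb A_\nu$, $\nu\in\mathcal A$; $\pi\cdot C:\mathrm{sort}(C)$; $\pi\cdot X:\mathrm{sort}(X)$; $\mathsf f(r):\tau$ if $r:\alpha$ and $\mathsf f$ has arity $(\alpha)\tau$; $(r_1,\dots,r_n):(\alpha_1,\dots,\alpha_n)$ if $r_i:\alpha_i$; $[a]r:[\nu]\alpha$ if $a\in\mathbb A_\nu$, $\nu\in\mathcal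 A$, $r:\alpha$. **Interpretations and validity.** A $\Sigma$-interpretation $\mathcal I$ assigns to each sort $\alpha$ a permissive-nominal set $[\![\alpha]\!]^{\mathcal I}$ (permission sets in $\mathcal P$), together with: equivariant injective maps $\mathbb A_\nu\to[\![\nu]\!]^{\mathcal I}$, written $a^{\mathcal I}$; $[\mathbb A_\nu][\![\alpha]\!]^{\mathcal I}\to[\![[\nu]\alpha]\!]^{\mathcal I}$, written $[a]^{\mathcal I}x$; $\prod_i[\![\alpha_i]\!]^{\mathcal I}\to[\![(\alpha_1,\dots,\alpha_n)]\!]^{\mathcal I}$, written $(x_1,\dots,x_n)^{\mathcal I}$; an equivariant map $\mathsf f^{\mathcal I}:[\![\alpha]\!]^{\mathcal I}\to[\![\tau]\!]^{\mathcal I}$ for each $\mathsf f$ of arity $(\alpha)\tau$; and $C^{\mathcal I}\in[\![\mathrm{sort}(C)]\!]^{\mathcal I}$ with $\mathrm{supp}(C^{\mathcal I})\subseteq\mathrm{pmss}(C)$. A valuation $\varsigma$ to $\mathcal I$ maps each unknown $X$ to some $\varsigma(X)\in[\![\mathrm{sort}(X)]\!]^{\mathcal I}$ with $\mathrm{supp}(\varsigma(X))\subseteq\mathrm{fa}(X)$. Terms: $[\![a]\!]^{\mathcal I}_\varsigma=a^{\mathcal I}$, $[\![\pi\cdot C]\!]^{\mathcal I}_\varsigma=\pi\cdot C^{\mathcal I}$, $[\![\pi\cdot X]\!]^{\mathcal I}_\varsigma=\pi\cdot\varsigma(X)$, $[\![\mathsf f(r)]\!]^{\mathcal I}_\varsigma=\mathsf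 f^{\mathcal I}([\![r]\!]^{\mathcal I}_\varsigma)$, $[\![(r_1,\dots,r_n)]\!]^{\mathcal I}_\varsigma=([\![r_1]\!]^{\mathcal I}_\varsigma,\dots,[\![r_n]\!]^{\mathcal I}_\varsigma)^{\mathcal I}$, $[\![[a]r]\!]^{\mathcal I}_\varsigma=[a]^{\mathcal I}[\![r]\!]^{\mathcal I}_\varsigma$. $\mathcal I\vDash r=s$ means $[\![r]\!]^{\mathcal I}_\varsigma=[\![s]\!]^{\mathcal I}_\varsigma$ for every valuation $\varsigma$. A theory $\mathsf T=(\Sigma,\mathit{Ax})$ is a signature with a set of equality axioms; $\mathcal I\vDash\mathsf T$ means $\mathcal I\vDash r=s$ for every $(r=s)\in\mathit{Ax}$. $\mathcal I$ has finite support when $\mathrm{supp}(x)$ is finite for every sort $\alpha$ and every $x\in[\![\alpha]\!]^{\mathcal I}$. $\mathsf T\vDash r=s$ means: for every $\Sigma$-interpretation $\mathcal I$, $\mathcal I\vDash\mathsf T$ implies $\mathcal I\vDash r=s$; $\mathsf T\vDash_{fin}r=s$ is the same restricted to $\Sigma$-interpretations with finite support.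
   Formalization: supp(x) is taken least only among supporting sets included in some permission set: the set of all atoms but c supports every element, so an unrestricted least support would always be empty and the claim false. Carriers of interpretations are small sets. -}

module Defs where

open import Algebra.Bundles using (Group)
open import Data.List.Base using (List; []; _∷_; _++_; reverse; map; filter; [_])
open import Data.List.Membership.Propositional using () renaming (_∈_ to _∈ₗ_)
open import Data.List.Membership.Propositional.Properties using (∈-filter⁺)
open import Data.List.Properties using (unfold-reverse; reverse-involutive)
open import Data.List.Relation.Unary.All using (All; []; _∷_)
open import Data.List.Relation.Unary.All.Properties using (all-filter)
open import Data.List.Relation.Unary.Any using (here; there)
open import Data.Nat.Base using (ℕ)
open import Data.Nat.Properties using () renaming (_≟_ to _≟ℕ_)
open import Data.Product.Base using (Σ-syntax; ∃-syntax; _×_; _,_; proj₁; proj₂)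
open import Data.Product.Relation.Binary.Pointwise.NonDependent using (×-setoid)
open import Data.Sum.Base using (_⊎_; inj₁; inj₂)
open import Data.Unit.Polymorphic.Base using (⊤)
open import Function.Base using (_∘_; _on_)
open import Function.Definitions using (Congruent; Injective)
open import Level using (0ℓ)
open import Relation.Binary.Bundles using (Setoid)
open import Relation.Binary.Definitions using (DecidableEquality)
open import Relation.Binary.PropositionalEquality.Core
  using (_≡_; _≢_; refl; sym; trans; cong; subst)
open import Relation.Binary.PropositionalEquality.Properties using (isEquivalence)
import Relation.Binary.PropositionalEquality.Properties as ≡
import Relation.Binary.Construct.On as On
open import Relation.Nullary.Decidable.Core using (yes; no; Dec)
open import Relation.Nullary.Negation.Core using (contradiction)
open import Relation.Unary using (Pred; _∈_; _∉_; _⊆_; _≐_; _∪_; _∖_; Stable)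

data Half : Set where
  below above : Half

record Atom : Set where
  constructor atom
  field
    sort  : ℕ
    half  : Half
    index : ℕ

open Atom

_≟ʰ_ : DecidableEquality Half
below ≟ʰ below = yes refl
below ≟ʰ above = no λ ()
above ≟ʰ below = no λ ()
above ≟ʰ above = yes refl

_≟_ : DecidableEquality Atom
atom i h m ≟ atom j k n with i ≟ℕ j | h ≟ʰ k | m ≟ℕ n
... | yes refl | yes refl | yes refl = yes refl
... | no i≢j   | _        | _        = no λ { refl → i≢j refl }
... | yes _    | no h≢k   | _        = no λ { refl → h≢k refl }
... | yes _    | yes _    | no m≢n   = no λ { refl → m≢n refl }

𝔸 : ℕ → Set
𝔸 ν = Σ[ a ∈ Atom ] sort a ≡ ν

𝔸< 𝔸> : Pred Atom 0ℓ
𝔸< a = half a ≡ below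
𝔸> a = half a ≡ above

record Swapping : Set where
  constructor swapping
  field
    fst snd   : Atom
    same-sort : sort fst ≡ sort snd

swap : Atom → Atom → Atom → Atom
swap a b c with c ≟ a | c ≟ b
... | yes _ | _     = b
... | no _  | yes _ = a
... | no _  | no _  = c

swap-invol : ∀ a b c → swap a b (swap a b c) ≡ c
swap-invol a b c with c ≟ a | c ≟ b
swap-invol a b c | yes refl | _ with b ≟ a | b ≟ b
... | yes b≡a | _      = b≡a
... | no _    | yes _  = refl
... | no _    | no b≢b = contradiction refl b≢b
swap-invol a b c | no _ | yes refl with a ≟ a
... | yes _  = refl
... | no a≢a = contradiction refl a≢a
swap-invol a b c | no c≢a | no c≢b with c ≟ a | c ≟ b
... | yes c≡a | _       = contradiction c≡a c≢a
... | no _    | yes c≡b = contradiction c≡b c≢b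
... | no _    | no _    = refl

swap-sort : ∀ a b → sort a ≡ sort b → ∀ c → sort (swap a b c) ≡ sort c
swap-sort a b eq c with c ≟ a | c ≟ b
... | yes refl | _        = sym eq
... | no _     | yes refl = eq
... | no _     | no _     = refl

-- The group generated by the swappings is presented as the words in the
-- swappings, two words being equal when they denote the same bijection.
Perm : Set
Perm = List Swapping

infixr 20 _⟨$⟩_

_⟨$⟩_ : Perm → Atom → Atom
[]                     ⟨$⟩ c = c
(swapping a b _ ∷ π) ⟨$⟩ c = swap a b (π ⟨$⟩ c)

++-⟨$⟩ : ∀ π ρ c → (π ++ ρ) ⟨$⟩ c ≡ π ⟨$⟩ ρ ⟨$⟩ c
++-⟨$⟩ []                    ρ c = refl
++-⟨$⟩ (swapping a b _ ∷ π) ρ c = cong (swap a b) (++-⟨$⟩ π ρ c)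

reverse-inverseʳ : ∀ π c → π ⟨$⟩ reverse π ⟨$⟩ c ≡ c
reverse-inverseʳ []       c = refl
reverse-inverseʳ (s@(swapping a b _) ∷ π) c
  rewrite unfold-reverse s π
        | ++-⟨$⟩ (reverse π) [ s ] c
        | reverse-inverseʳ π (swap a b c) = swap-invol a b c

reverse-inverseˡ : ∀ π c → reverse π ⟨$⟩ π ⟨$⟩ c ≡ c
reverse-inverseˡ []       c = refl
reverse-inverseˡ (s@(swapping a b _) ∷ π) c
  rewrite unfold-reverse s π
        | ++-⟨$⟩ (reverse π) [ s ] (swap a b (π ⟨$⟩ c))
        | swap-invol a b (π ⟨$⟩ c) = reverse-inverseˡ π c

⟨$⟩-sort : ∀ π c → sort (π ⟨$⟩ c) ≡ sort c
⟨$⟩-sort []                     c = refl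
⟨$⟩-sort (swapping a b eq ∷ π) c =
  trans (swap-sort a b eq (π ⟨$⟩ c)) (⟨$⟩-sort π c)

ℙ : Group 0ℓ 0ℓ
ℙ = record
  { Carrier = Perm
  ; _≈_     = λ π ρ → ∀ c → π ⟨$⟩ c ≡ ρ ⟨$⟩ c
  ; _∙_     = _++_
  ; ε       = []
  ; _⁻¹     = reverse
  ; isGroup = record
    { isMonoid = record
      { isSemigroup = record
        { isMagma = record
          { isEquivalence = record
            { refl  = λ c → refl
            ; sym   = λ p c → sym (p c)
            ; trans = λ p q c → trans (p c) (q c)
            }
          ; ∙-cong = λ {π} {π′} {ρ} {ρ′} p q c →
              trans (++-⟨$⟩ π ρ c)
                (trans (cong (π ⟨$⟩_) (q c))
                  (trans (p (ρ′ ⟨$⟩ c)) (sym (++-⟨$⟩ π′ ρ′ c))))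
          }
        ; assoc = λ π ρ σ c →
            trans (++-⟨$⟩ (π ++ ρ) σ c)
              (trans (++-⟨$⟩ π ρ (σ ⟨$⟩ c))
                (trans (cong (π ⟨$⟩_) (sym (++-⟨$⟩ ρ σ c)))
                  (sym (++-⟨$⟩ π (ρ ++ σ) c))))
        }
      ; identity = (λ π c → refl) , (λ π c → ++-⟨$⟩ π [] c)
      }
    ; inverse =
        (λ π c → trans (++-⟨$⟩ (reverse π) π c) (reverse-inverseˡ π c)) ,
        (λ π c → trans (++-⟨$⟩ π (reverse π) c) (reverse-inverseʳ π c))
    ; ⁻¹-cong = λ {π} {ρ} p c →
        trans (cong (reverse π ⟨$⟩_) (sym (reverse-inverseʳ ρ c)))
          (trans (cong (reverse π ⟨$⟩_) (sym (p (reverse ρ ⟨$⟩ c))))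
            (reverse-inverseˡ π (reverse ρ ⟨$⟩ c)))
    }
  }

open Group ℙ using () renaming (_≈_ to _≈ₚ_; _∙_ to _∘ₚ_; ε to idₚ; _⁻¹ to _⁻¹ₚ)

-- The sets (𝔸< ∖ A) ∪ B, with the finite A ⊆ 𝔸< and B ⊆ 𝔸> given by lists.
record PermissionSet : Set where
  field
    removed   : List Atom
    added     : List Atom
    removed⊆< : All 𝔸< removed
    added⊆>   : All 𝔸> added

  ⌊_⌋ : Pred Atom 0ℓ
  ⌊_⌋ = (𝔸< ∖ (_∈ₗ removed)) ∪ (_∈ₗ added)

open PermissionSet public using (⌊_⌋)

-- Only a bound is demanded: the list may contain further atoms.
Finite : Pred Atom 0ℓ → Set
Finite A = ∃[ as ] A ⊆ (_∈ₗ as)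

record PermSet : Set₁ where
  infixr 20 _·_
  field
    setoid : Setoid 0ℓ 0ℓ
  open Setoid setoid public renaming (refl to ≈-refl; sym to ≈-sym; trans to ≈-trans)
  field
    _·_    : Perm → Carrier → Carrier
    ·-cong : ∀ {π ρ x y} → π ≈ₚ ρ → x ≈ y → π · x ≈ ρ · y
    ·-id   : ∀ x → idₚ · x ≈ x
    ·-∘    : ∀ π ρ x → (π ∘ₚ ρ) · x ≈ π · ρ · x

∣_∣ : PermSet → Set
∣_∣ = PermSet.Carrier

Supports : (X : PermSet) → Pred Atom 0ℓ → Pred ∣ X ∣ 0ℓ
Supports X A x = ∀ π → (∀ {a} → a ∈ A → π ⟨$⟩ a ≡ a) → π · x ≈ x
  where open PermSet X

Permitted : Pred Atom 0ℓ → Set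
Permitted A = Σ[ S ∈ PermissionSet ] A ⊆ ⌊ S ⌋

-- A is the least among the supporting sets that are included in some
-- permission set.  The competitors must be bounded in this way: the set
-- 𝔸 ∖ {c} is fixed pointwise only by the identity, so it supports every x,
-- and an unrestricted least supporting set would always be empty.
--
-- Stability imposes no condition classically, but without it leastness would
-- fail constructively: swapping arguments only refute c ∉ A′.
record IsSupport (X : PermSet) (x : ∣ X ∣) (A : Pred Atom 0ℓ) : Set₁ where
  field
    stable    : Stable A
    supports  : Supports X A x
    permitted : Permitted A
    least     : ∀ {A′} → Stable A′ → Supports X A′ x → Permitted A′ → A ⊆ A′

record PermissiveNominalSet : Set₁ where
  field
    permSet   : PermSet
    supp      : ∣ permSet ∣ → Pred Atom 0ℓ
    isSupport : ∀ x → IsSupport permSet x (supp x)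
  open PermSet permSet public

record Equivariant (X Y : PermSet) : Set where
  private
    module X = PermSet X
    module Y = PermSet Y
  field
    to          : ∣ X ∣ → ∣ Y ∣
    to-cong     : Congruent X._≈_ Y._≈_ to
    equivariant : ∀ π x → to (π X.· x) Y.≈ π Y.· to x

record EquivariantInjection (X Y : PermSet) : Set where
  field
    equivariantMap : Equivariant X Y
  open Equivariant equivariantMap public
  field
    injective : Injective (PermSet._≈_ X) (PermSet._≈_ Y) to

𝔸-permSet : ℕ → PermSet
𝔸-permSet ν = record
  { setoid = record
    { Carrier       = 𝔸 ν
    ; _≈_           = _≡_ on proj₁
    ; isEquivalence = On.isEquivalence proj₁ isEquivalence
    }
  ; _·_    = λ π (a , p) → π ⟨$⟩ a , trans (⟨$⟩-sort π a) p
  ; ·-cong = λ {π} {ρ} {x} {y} π≈ρ x≈y →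
      trans (cong (π ⟨$⟩_) x≈y) (π≈ρ (proj₁ y))
  ; ·-id   = λ _ → refl
  ; ·-∘    = λ π ρ (a , _) → ++-⟨$⟩ π ρ a
  }

∏ : List PermSet → PermSet
∏ [] = record
  { setoid = ≡.setoid ⊤
  ; _·_    = λ _ x → x
  ; ·-cong = λ _ p → p
  ; ·-id   = λ _ → refl
  ; ·-∘    = λ _ _ _ → refl
  }
∏ (X ∷ Xs) = record
  { setoid = ×-setoid X.setoid Xs.setoid
  ; _·_    = λ π (x , xs) → π X.· x , π Xs.· xs
  ; ·-cong = λ π≈ρ (p , ps) → X.·-cong π≈ρ p , Xs.·-cong π≈ρ ps
  ; ·-id   = λ (x , xs) → X.·-id x , Xs.·-id xs
  ; ·-∘    = λ π ρ (x , xs) → X.·-∘ π ρ x , Xs.·-∘ π ρ xs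
  }
  where
  module X  = PermSet X
  module Xs = PermSet (∏ Xs)

module _ (π : Perm) where

  ⟨$⟩-injective : ∀ {a b} → π ⟨$⟩ a ≡ π ⟨$⟩ b → a ≡ b
  ⟨$⟩-injective {a} {b} p =
    trans (sym (reverse-inverseˡ π a))
      (trans (cong (reverse π ⟨$⟩_) p) (reverse-inverseˡ π b))

  conj-swap : ∀ a b c → π ⟨$⟩ swap a b c ≡ swap (π ⟨$⟩ a) (π ⟨$⟩ b) (π ⟨$⟩ c)
  conj-swap a b c with c ≟ a | c ≟ b
                     | (π ⟨$⟩ c) ≟ (π ⟨$⟩ a) | (π ⟨$⟩ c) ≟ (π ⟨$⟩ b)
  ... | yes _    | _        | yes _ | _     = refl
  ... | yes refl | _        | no q  | _     = contradiction refl q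
  ... | no p     | _        | yes q | _     = contradiction (⟨$⟩-injective q) p
  ... | no _     | yes _    | no _  | yes _ = refl
  ... | no _     | yes refl | no _  | no q  = contradiction refl q
  ... | no _     | no p     | no _  | yes q = contradiction (⟨$⟩-injective q) p
  ... | no _     | no _     | no _  | no _  = refl

permitted-swap : ∀ {A} a b → Permitted A → Permitted (A ∘ swap a b)
permitted-swap {A} a b (S , A⊆S) = S′ , λ {c} c∈ → bound c (A⊆S c∈)
  where
  above? : ∀ c → Dec (𝔸> c)
  above? c = half c ≟ʰ above

  candidates : List Atom
  candidates = a ∷ b ∷ PermissionSet.added S

  S′ : PermissionSet
  S′ = record
    { removed   = []
    ; added     = filter above? candidates
    ; removed⊆< = []
    ; added⊆>   = all-filter above? candidates
    }

  in-S′ : ∀ c → (𝔸> c → c ∈ₗ candidates) → c ∈ ⌊ S′ ⌋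
  in-S′ (atom i below n) h = inj₁ (refl , λ ())
  in-S′ (atom i above n) h = inj₂ (∈-filter⁺ above? (h refl) refl)

  in-S : ∀ c → c ∈ ⌊ S ⌋ → 𝔸> c → c ∈ₗ candidates
  in-S (atom i above n) (inj₁ (() , _)) _
  in-S c                (inj₂ c∈B)      _ = there (there c∈B)

  bound : ∀ c → swap a b c ∈ ⌊ S ⌋ → c ∈ ⌊ S′ ⌋
  bound c c∈ with c ≟ a | c ≟ b
  ... | yes refl | _        = in-S′ c λ _ → here refl
  ... | no _     | yes refl = in-S′ c λ _ → there (here refl)
  ... | no _     | no _     = in-S′ c (in-S c c∈)

permitted-perm : ∀ {A} π → Permitted A → Permitted (A ∘ (π ⟨$⟩_))
permitted-perm []                    P = P
permitted-perm (swapping a b _ ∷ π) P =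
  permitted-perm π (permitted-swap a b P)

module _ (X : PermissiveNominalSet) where
  open PermissiveNominalSet X

  ·-inverseˡ : ∀ π x → (π ⁻¹ₚ) · π · x ≈ x
  ·-inverseˡ π x = ≈-trans (≈-sym (·-∘ (π ⁻¹ₚ) π x))
    (≈-trans (·-cong {ρ = idₚ} (Group.inverseˡ ℙ π) ≈-refl) (·-id x))

  ·-inverseʳ : ∀ π x → π · (π ⁻¹ₚ) · x ≈ x
  ·-inverseʳ π x = ≈-trans (≈-sym (·-∘ π (π ⁻¹ₚ) x))
    (≈-trans (·-cong {ρ = idₚ} (Group.inverseʳ ℙ π) ≈-refl) (·-id x))

  ·-congˡ : ∀ π {x y} → x ≈ y → π · x ≈ π · y
  ·-congˡ π = ·-cong {π} {π} (λ _ → refl)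

  supports-image : ∀ π x → Supports permSet (supp x ∘ ((π ⁻¹ₚ) ⟨$⟩_)) (π · x)
  supports-image π x ρ fix =
    ≈-trans (≈-sym (·-inverseʳ π (ρ · π · x)))
      (·-congˡ π (≈-trans (≈-sym eq) (IsSupport.supports (isSupport x) σ fixσ)))
    where
    σ : Perm
    σ = (π ⁻¹ₚ) ∘ₚ (ρ ∘ₚ π)

    eq : σ · x ≈ (π ⁻¹ₚ) · ρ · π · x
    eq = ≈-trans (·-∘ (π ⁻¹ₚ) (ρ ∘ₚ π) x) (·-congˡ (π ⁻¹ₚ) (·-∘ ρ π x))

    fixσ : ∀ {a} → a ∈ supp x → σ ⟨$⟩ a ≡ a
    fixσ {a} a∈ =
      trans (++-⟨$⟩ (π ⁻¹ₚ) (ρ ∘ₚ π) a)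
        (trans (cong ((π ⁻¹ₚ) ⟨$⟩_)
                 (trans (++-⟨$⟩ ρ π a)
                   (fix (subst (supp x) (sym (reverse-inverseˡ π a)) a∈))))
          (reverse-inverseˡ π a))

  supp-image : ∀ π x → supp (π · x) ⊆ supp x ∘ ((π ⁻¹ₚ) ⟨$⟩_)
  supp-image π x = IsSupport.least (isSupport (π · x))
    (λ c → IsSupport.stable (isSupport x) ((π ⁻¹ₚ) ⟨$⟩ c))
    (supports-image π x)
    (permitted-perm (π ⁻¹ₚ) (IsSupport.permitted (isSupport x)))

  supp-cong : ∀ {x y} → x ≈ y → supp x ⊆ supp y
  supp-cong {x} {y} x≈y = IsSupport.least (isSupport x)
    (IsSupport.stable (isSupport y))
    (λ π fix → ≈-trans (·-congˡ π x≈y)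
      (≈-trans (IsSupport.supports (isSupport y) π fix) (≈-sym x≈y)))
    (IsSupport.permitted (isSupport y))

  supp-preimage : ∀ π x → supp x ⊆ supp (π · x) ∘ (π ⟨$⟩_)
  supp-preimage π x {c} c∈ =
    subst (λ ρ → supp (π · x) (ρ ⟨$⟩ c)) (reverse-involutive π)
      (supp-image (π ⁻¹ₚ) (π · x) (supp-cong (≈-sym (·-inverseˡ π x)) c∈))

module Abstraction (ν : ℕ) (X : PermissiveNominalSet) where
  open PermissiveNominalSet X

  swapₐ : 𝔸 ν → 𝔸 ν → Perm
  swapₐ (b , q) (a , p) = [ swapping b a (trans q (sym p)) ]

  -- The set [a]x = {(a,x)} ∪ {(b,(b a)·x) ∣ b ∈ 𝔸_ν ∖ supp(x), b ≠ a}.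
  ⟨_⟩_ : 𝔸 ν → Carrier → Pred (𝔸 ν × Carrier) 0ℓ
  (⟨ a ⟩ x) (b , y) =
      (proj₁ b ≡ proj₁ a × y ≈ x)
    ⊎ (proj₁ b ∉ supp x × proj₁ b ≢ proj₁ a × y ≈ swapₐ b a · x)

  module 𝔸ν = PermSet (𝔸-permSet ν)

  ⟨⟩-cong : ∀ {a b x y} → a 𝔸ν.≈ b → x ≈ y → (⟨ a ⟩ x) ⊆ (⟨ b ⟩ y)
  ⟨⟩-cong a≡b x≈y (inj₁ (c≡a , z≈x)) =
    inj₁ (trans c≡a a≡b , ≈-trans z≈x x≈y)
  ⟨⟩-cong {a = a , _} {x = x} refl x≈y {(c , _) , z} (inj₂ (c∉ , c≢a , z≈)) =
    inj₂ ( c∉ ∘ supp-cong X (≈-sym x≈y)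
         , c≢a
         , ≈-trans z≈ (·-cong (λ _ → refl) x≈y) )

  ⟨⟩-image : ∀ π a x {b y} → (⟨ a ⟩ x) (b , y) →
             (⟨ π 𝔸ν.· a ⟩ (π · x)) (π 𝔸ν.· b , π · y)
  ⟨⟩-image π a x (inj₁ (b≡a , y≈x)) = inj₁ (cong (π ⟨$⟩_) b≡a , ·-congˡ X π y≈x)
  ⟨⟩-image π a x {b} {y} (inj₂ (b∉ , b≢a , y≈)) = inj₂
    ( (λ πb∈ → b∉ (subst (supp x) (reverse-inverseˡ π (proj₁ b)) (supp-image X π x πb∈)))
    , b≢a ∘ ⟨$⟩-injective π
    , ≈-trans (·-congˡ X π y≈)
        (≈-trans (≈-sym (·-∘ π (swapₐ b a) x))
          (≈-trans (·-cong conj ≈-refl)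
            (·-∘ (swapₐ (π 𝔸ν.· b) (π 𝔸ν.· a)) π x))) )
    where
    conj : (π ∘ₚ swapₐ b a) ≈ₚ (swapₐ (π 𝔸ν.· b) (π 𝔸ν.· a) ∘ₚ π)
    conj c = trans (++-⟨$⟩ π (swapₐ b a) c) (conj-swap π (proj₁ b) (proj₁ a) c)

  ⟨⟩-resp : ∀ a x {b b′ y y′} → b 𝔸ν.≈ b′ → y ≈ y′ →
            (⟨ a ⟩ x) (b , y) → (⟨ a ⟩ x) (b′ , y′)
  ⟨⟩-resp a x refl y≈ (inj₁ (p , q)) = inj₁ (p , ≈-trans (≈-sym y≈) q)
  ⟨⟩-resp a x refl y≈ (inj₂ (p , q , r)) =
    inj₂ (p , q , ≈-trans (≈-sym y≈) (≈-trans r (·-cong (λ _ → refl) ≈-refl)))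

  ⟨⟩-preimage : ∀ π a x {b y} → (⟨ π 𝔸ν.· a ⟩ (π · x)) (b , y) →
                (⟨ a ⟩ x) ((π ⁻¹ₚ) 𝔸ν.· b , (π ⁻¹ₚ) · y)
  ⟨⟩-preimage π a x m =
    ⟨⟩-cong {a = (π ⁻¹ₚ) 𝔸ν.· π 𝔸ν.· a} {b = a} (reverse-inverseˡ π (proj₁ a))
      (·-inverseˡ X π x)
      (⟨⟩-image (π ⁻¹ₚ) (π 𝔸ν.· a) (π · x) m)

  ⟨⟩-mono : ∀ π a x b y → (⟨ a ⟩ x) ⊆ (⟨ b ⟩ y) →
            (⟨ π 𝔸ν.· a ⟩ (π · x)) ⊆ (⟨ π 𝔸ν.· b ⟩ (π · y))
  ⟨⟩-mono π a x b y sub {c , z} m =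
    ⟨⟩-resp (π 𝔸ν.· b) (π · y) (reverse-inverseʳ π (proj₁ c)) (·-inverseʳ X π z)
      (⟨⟩-image π b y (sub (⟨⟩-preimage π a x m)))

  -- An element [a]x is represented by the pair (a , x).  Pairs are identified
  -- when they determine the same set.
  abstraction : PermSet
  abstraction = record
    { setoid = record
      { Carrier       = 𝔸 ν × Carrier
      ; _≈_           = λ (a , x) (b , y) → (⟨ a ⟩ x) ≐ (⟨ b ⟩ y)
      ; isEquivalence = record
        { refl  = (λ m → m) , (λ m → m)
        ; sym   = λ (p , q) → q , p
        ; trans = λ (p , q) (p′ , q′) → (λ m → p′ (p m)) , (λ m → q (q′ m))
        }
      }
    ; _·_    = λ π (a , x) → π 𝔸ν.· a , π · x
    ; ·-cong = λ {π} {ρ} {(a , x)} {(b , y)} π≈ρ (p , q) →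
          (λ m → ⟨⟩-cong {a = π 𝔸ν.· b} {b = ρ 𝔸ν.· b} (π≈ρ (proj₁ b)) (·-cong π≈ρ ≈-refl)
                   (⟨⟩-mono π a x b y p m))
        , (λ m → ⟨⟩-mono π b y a x q
                   (⟨⟩-cong {a = ρ 𝔸ν.· b} {b = π 𝔸ν.· b} (sym (π≈ρ (proj₁ b)))
                     (·-cong (λ c → sym (π≈ρ c)) ≈-refl) m))
    ; ·-id   = λ (a , x) →
          ⟨⟩-cong {a = idₚ 𝔸ν.· a} {b = a} refl (·-id x)
        , ⟨⟩-cong {a = a} {b = idₚ 𝔸ν.· a} refl (≈-sym (·-id x))
    ; ·-∘    = λ π ρ (a , x) →
          ⟨⟩-cong {a = (π ∘ₚ ρ) 𝔸ν.· a} {b = π 𝔸ν.· ρ 𝔸ν.· a}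
            (++-⟨$⟩ π ρ (proj₁ a)) (·-∘ π ρ x)
        , ⟨⟩-cong {a = π 𝔸ν.· ρ 𝔸ν.· a} {b = (π ∘ₚ ρ) 𝔸ν.· a}
            (sym (++-⟨$⟩ π ρ (proj₁ a))) (≈-sym (·-∘ π ρ x))
    }

[𝔸_]_ : ℕ → PermissiveNominalSet → PermSet
[𝔸 ν ] X = Abstraction.abstraction ν X

-- Membership in the set of name sorts is irrelevant, so that a name sort is
-- determined by its number.
data Sort (NameSort : Pred ℕ 0ℓ) (BaseSort : Set) : Set where
  name : (ν : ℕ) → .(ν ∈ NameSort) → Sort NameSort BaseSort
  base : BaseSort → Sort NameSort BaseSort
  tup  : List (Sort NameSort BaseSort) → Sort NameSort BaseSort
  abs  : (ν : ℕ) → .(ν ∈ NameSort) → Sort NameSort BaseSort → Sort NameSort BaseSort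

record Signature : Set₁ where
  field
    NameSort : Pred ℕ 0ℓ
    BaseSort : Set

  Sorts : Set
  Sorts = Sort NameSort BaseSort

  field
    Constant   : Set
    sortC      : Constant → BaseSort
    pmss       : Constant → Pred Atom 0ℓ
    pmss⊆<     : ∀ C → pmss C ⊆ 𝔸<
    Unknown    : Set
    sortX      : Unknown → Sorts
    fa         : Unknown → PermissionSet
    TermFormer : Set
    argument   : TermFormer → Sorts
    result     : TermFormer → BaseSort

module _ (Sig : Signature) where
  open Signature Sig

  data Term : Sorts → Set where
    atm : ∀ {ν} .(ν∈ : ν ∈ NameSort) → 𝔸 ν → Term (name ν ν∈)
    con : Perm → (C : Constant) → Term (base (sortC C))
    unk : Perm → (X : Unknown) → Term (sortX X)
    app : (f : TermFormer) → Term (argument f) → Term (base (result f))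
    tup : ∀ {αs} → All Term αs → Term (tup αs)
    abs : ∀ {ν α} .(ν∈ : ν ∈ NameSort) → 𝔸 ν → Term α → Term (abs ν ν∈ α)

  record Interpretation : Set₁ where
    field
      ⟦_⟧ : Sorts → PermissiveNominalSet

    ⟦_⟧ₚ : Sorts → PermSet
    ⟦ α ⟧ₚ = PermissiveNominalSet.permSet ⟦ α ⟧

    module ⟦⟧ (α : Sorts) = PermissiveNominalSet ⟦ α ⟧

    field
      atmᴵ  : ∀ ν .(ν∈ : ν ∈ NameSort) →
              EquivariantInjection (𝔸-permSet ν) ⟦ name ν ν∈ ⟧ₚ
      absᴵ  : ∀ ν .(ν∈ : ν ∈ NameSort) α →
              EquivariantInjection ([𝔸 ν ] ⟦ α ⟧) ⟦ abs ν ν∈ α ⟧ₚ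
      tupᴵ  : ∀ αs → EquivariantInjection (∏ (map ⟦_⟧ₚ αs)) ⟦ tup αs ⟧ₚ
      appᴵ  : ∀ f → Equivariant ⟦ argument f ⟧ₚ ⟦ base (result f) ⟧ₚ
      conᴵ  : ∀ C → ∣ ⟦ base (sortC C) ⟧ₚ ∣
      conᴵ⊆ : ∀ C → ⟦⟧.supp (base (sortC C)) (conᴵ C) ⊆ pmss C

  module _ (I : Interpretation) where
    open Interpretation I

    record Valuation : Set where
      field
        val  : ∀ X → ∣ ⟦ sortX X ⟧ₚ ∣
        val⊆ : ∀ X → ⟦⟧.supp (sortX X) (val X) ⊆ ⌊ fa X ⌋

    module _ (ς : Valuation) where
      open Valuation ς

      eval  : ∀ {α} → Term α → ∣ ⟦ α ⟧ₚ ∣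
      evals : ∀ {αs} → All Term αs → ∣ ∏ (map ⟦_⟧ₚ αs) ∣

      eval (atm {ν} ν∈ a)       = EquivariantInjection.to (atmᴵ ν ν∈) a
      eval (con π C)            = ⟦⟧._·_ (base (sortC C)) π (conᴵ C)
      eval (unk π X)            = ⟦⟧._·_ (sortX X) π (val X)
      eval (app f r)            = Equivariant.to (appᴵ f) (eval r)
      eval (tup {αs} rs)        = EquivariantInjection.to (tupᴵ αs) (evals rs)
      eval (abs {ν} {α} ν∈ a r) = EquivariantInjection.to (absᴵ ν ν∈ α) (a , eval r)

      evals []       = _
      evals (r ∷ rs) = eval r , evals rs

    Satisfies : ∀ {α} → Term α → Term α → Set
    Satisfies {α} r s = ∀ ς → ⟦⟧._≈_ α (eval ς r) (eval ς s)

    FinitelySupported : Set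
    FinitelySupported = ∀ α x → Finite (⟦⟧.supp α x)

record Theory : Set₁ where
  field
    signature : Signature
    Axiom     : ∀ {α} → Term signature α → Term signature α → Set

Models : (T : Theory) → Interpretation (Theory.signature T) → Set
Models T I = ∀ {α} {r s : Term signature α} → Axiom r s → Satisfies signature I r s
  where open Theory T

module _ (T : Theory) {α} (r s : Term (Theory.signature T) α) where
  open Theory T

  Entails : Set₁
  Entails = ∀ I → Models T I → Satisfies signature I r s

  Entails-fin : Set₁
  Entails-fin = ∀ I → FinitelySupported signature I → Models T I → Satisfies signature I r s

{-# OPTIONS --safe #-}
module Submission where

-- Elements of permissive-nominal sets may have infinite support, and infinitely
-- many axioms can make an assertion fail only in models with such elements.
-- Take a constant  point,  whose support may be any subset of the lower atoms, a
-- constant  falsity  with empty support, and a binary term-former  equal.  For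
-- all distinct lower atoms a and b of sort 0 there is an axiom
--
--     equal(point, (a b)·point) = falsity.
--
-- The assertion is  equal(point, point) = falsity.
--
-- In a model with finite support, two distinct lower atoms a and b of sort 0
-- lie outside the support of  point.  Then (a b)·point = point, and the axiom
-- for a and b is the assertion.
--
-- In general the assertion may fail.  Interpret the sort of  point  by the
-- finite permutations restricted to the lower atoms, acted on by composition
-- on the left, let  point  be the inclusion of the lower atoms, and let  equal
-- decide equality.  A nontrivial swapping of lower atoms moves the inclusion,
-- so the axioms hold, but the inclusion is equal to itself.  The support of
-- the restriction of ρ is the image under ρ of the set of lower atoms, which
-- is included in a permission set.  It is least by  restriction-isSupport:
-- if c is in this image and A′ is a permitted supporting set without c, then
-- some upper atom e of the sort of c is outside A′, and (c e) fixes A′ pointwise but moves the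
-- restriction of ρ.

open import Defs
open import Data.Bool.Base using (Bool; false)
open import Data.Empty using (⊥)
open import Data.List.Base using (List; []; _∷_; _++_; map; reverse; [_])
open import Data.List.Membership.Propositional using () renaming (_∈_ to _∈ₗ_; _∉_ to _∉ₗ_)
open import Data.List.Membership.Propositional.Properties using (∈-++⁺ˡ; ∈-++⁺ʳ)
open import Data.List.Relation.Unary.All using (All; []; _∷_; all?; lookup; tabulate)
open import Data.List.Relation.Unary.All.Properties using (++⁺)
open import Data.List.Relation.Unary.Any using (here; there; any?)
open import Data.Nat.Base using (ℕ; suc; _+_; _≤_)
open import Data.Nat.Properties using (m≤m+n; ≤-trans; m≤n+m; 1+n≰n)
open import Data.Product.Base using (Σ-syntax; ∃-syntax; _×_; _,_; proj₁; proj₂)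
open import Data.Sum.Base using (inj₁; inj₂; [_,_]′)
open import Data.Unit.Base using (⊤; tt)
open import Function.Base using (_∘_; id)
open import Function.Bundles using (mk⇔)
open import Level using (0ℓ)
open import Relation.Binary.PropositionalEquality
  using (_≡_; _≢_; refl; sym; trans; cong; subst; setoid)
open import Relation.Nullary.Decidable
  using (Dec; yes; no; does; map′; _→-dec_; decidable-stable; dec-true; dec-false; does-⇔)
open import Relation.Nullary.Negation.Core using (¬_; contradiction)
open import Relation.Unary using (Pred; _∈_; _∉_; _⊆_; _∪_; ∅)

open Atom

-- Fresh atoms and swappings

fresh : ∀ i h as → ∃[ n ] atom i h n ∉ₗ as
fresh i h as = suc (total as) , λ n∈ → 1+n≰n (index≤total n∈)
  where
  total : List Atom → ℕ
  total []       = 0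
  total (a ∷ as) = index a + total as

  index≤total : ∀ {a as} → a ∈ₗ as → index a ≤ total as
  index≤total {as = b ∷ bs} (here refl) = m≤m+n (index b) (total bs)
  index≤total {as = b ∷ bs} (there a∈)  = ≤-trans (index≤total a∈) (m≤n+m (total bs) (index b))

swap-left : ∀ a b → swap a b a ≡ b
swap-left a b with a ≟ a
... | yes _  = refl
... | no a≢a = contradiction refl a≢a

swap-fixes : ∀ {a b c} → c ≢ a → c ≢ b → swap a b c ≡ c
swap-fixes {a} {b} {c} c≢a c≢b with c ≟ a | c ≟ b
... | yes c≡a | _       = contradiction c≡a c≢a
... | no _    | yes c≡b = contradiction c≡b c≢b
... | no _    | no _    = refl

swap-fixes-⊆ : ∀ {A : Pred Atom 0ℓ} {a b} → a ∉ A → b ∉ A →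
               ∀ {c} → c ∈ A → swap a b c ≡ c
swap-fixes-⊆ a∉ b∉ c∈ = swap-fixes (λ { refl → a∉ c∈ }) (λ { refl → b∉ c∈ })

-- A permission set contains only finitely many upper atoms.
upper-fresh : ∀ i (S : PermissionSet) a →
              ∃[ n ] (atom i above n ∉ ⌊ S ⌋ × atom i above n ≢ a)
upper-fresh i S a with fresh i above (a ∷ PermissionSet.added S)
... | n , n∉ = n , [ (λ { (() , _) }) , n∉ ∘ there ]′ , n∉ ∘ here

-- Supports of invariant elements and of tuples

-- The set of lower atoms as a permission set.
lower : PermissionSet
lower = record { removed = [] ; added = [] ; removed⊆< = [] ; added⊆> = [] }

𝔸<⊆lower : 𝔸< ⊆ ⌊ lower ⌋
𝔸<⊆lower c< = inj₁ (c< , λ ())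

invariant-isSupport : ∀ X {x} → (∀ π → PermSet._≈_ X (PermSet._·_ X π x) x) → IsSupport X x ∅
invariant-isSupport X inv = record
  { stable    = λ _ ¬¬p → ¬¬p id
  ; supports  = λ π _ → inv π
  ; permitted = lower , λ ()
  ; least     = λ _ _ _ ()
  }

-- The union of two sets of atoms, closed under double negation so as to be
-- stable.
_∪ˢ_ : Pred Atom 0ℓ → Pred Atom 0ℓ → Pred Atom 0ℓ
(A ∪ˢ B) c = ¬ ¬ (c ∈ (A ∪ B))

-- A permission set need only include the union, so it may contain every lower
-- atom.
∪ˢ-permitted : ∀ {A B} → Permitted A → Permitted B → Permitted (A ∪ˢ B)
∪ˢ-permitted {A} {B} (S , A⊆S) (T , B⊆T) = U , λ {c} → bound c
  where
  module S = PermissionSet S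
  module T = PermissionSet T

  U : PermissionSet
  U = record
    { removed   = []
    ; added     = S.added ++ T.added
    ; removed⊆< = []
    ; added⊆>   = ++⁺ S.added⊆> T.added⊆>
    }

  bound : ∀ c → c ∈ (A ∪ˢ B) → c ∈ ⌊ U ⌋
  bound (atom i below n) _  = inj₁ (refl , λ ())
  bound c@(atom i above n) c∈ =
    inj₂ (decidable-stable (any? (c ≟_) (S.added ++ T.added)) λ c∉ →
      c∈ [ (λ a∈ → [ (λ { (() , _) }) , c∉ ∘ ∈-++⁺ˡ ]′ (A⊆S a∈))
         , (λ b∈ → [ (λ { (() , _) }) , c∉ ∘ ∈-++⁺ʳ S.added ]′ (B⊆T b∈)) ]′)

∷-isSupport : ∀ X Xs {x xs A B} → IsSupport X x A → IsSupport (∏ Xs) xs B →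
              IsSupport (∏ (X ∷ Xs)) (x , xs) (A ∪ˢ B)
∷-isSupport X Xs sx sxs = record
  { stable    = λ _ ¬¬p ¬q → ¬¬p λ p → p ¬q
  ; supports  = λ π fix →
      sx.supports π (λ c∈ → fix λ c∉ → c∉ (inj₁ c∈)) ,
      sxs.supports π (λ c∈ → fix λ c∉ → c∉ (inj₂ c∈))
  ; permitted = ∪ˢ-permitted sx.permitted sxs.permitted
  ; least     = λ st sup per {c} c∈ → st c λ c∉ → c∈
      [ c∉ ∘ sx.least st (λ π fix → proj₁ (sup π fix)) per
      , c∉ ∘ sxs.least st (λ π fix → proj₂ (sup π fix)) per ]′
  }
  where
  module sx  = IsSupport sx
  module sxs = IsSupport sxs

permSet : PermissiveNominalSet → PermSet
permSet = PermissiveNominalSet.permSet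

-- The finite product, with the union of the supports of the components as
-- support.
∏ₙ : List PermissiveNominalSet → PermissiveNominalSet
∏ₙ Xs = record
  { permSet   = ∏ (map permSet Xs)
  ; supp      = supps Xs
  ; isSupport = isSupports Xs
  }
  where
  supps : ∀ Xs → ∣ ∏ (map permSet Xs) ∣ → Pred Atom 0ℓ
  supps []       _        = ∅
  supps (X ∷ Xs) (x , xs) = PermissiveNominalSet.supp X x ∪ˢ supps Xs xs

  isSupports : ∀ Xs xs → IsSupport (∏ (map permSet Xs)) xs (supps Xs xs)
  isSupports []       _        = invariant-isSupport (∏ []) λ _ → refl
  isSupports (X ∷ Xs) (x , xs) =
    ∷-isSupport (permSet X) (map permSet Xs)
      (PermissiveNominalSet.isSupport X x) (isSupports Xs xs)

-- Finite permutations restricted to the lower atoms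

-- Agreement on the lower atoms.
_≈<_ : Perm → Perm → Set
ρ ≈< σ = ∀ c → c ∈ 𝔸< → ρ ⟨$⟩ c ≡ σ ⟨$⟩ c

-- A permutation stands for its restriction to the lower atoms.
restrictions : PermSet
restrictions = record
  { setoid = record
    { Carrier       = Perm
    ; _≈_           = _≈<_
    ; isEquivalence = record
      { refl  = λ _ _ → refl
      ; sym   = λ p c c< → sym (p c c<)
      ; trans = λ p q c c< → trans (p c c<) (q c c<)
      }
    }
  ; _·_    = _++_
  ; ·-cong = λ {π} {ρ} {x} {y} p q c c< →
      trans (++-⟨$⟩ π x c)
        (trans (cong (π ⟨$⟩_) (q c c<))
          (trans (p (y ⟨$⟩ c)) (sym (++-⟨$⟩ ρ y c))))
  ; ·-id   = λ _ _ _ → refl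
  ; ·-∘    = λ π ρ x c _ →
      trans (++-⟨$⟩ (π ++ ρ) x c)
        (trans (++-⟨$⟩ π ρ (x ⟨$⟩ c))
          (trans (cong (π ⟨$⟩_) (sym (++-⟨$⟩ ρ x c)))
            (sym (++-⟨$⟩ π (ρ ++ x) c))))
  }

-- The image of the set of lower atoms under a permutation.
image< : Perm → Pred Atom 0ℓ
image< ρ c = reverse ρ ⟨$⟩ c ∈ 𝔸<

restriction-isSupport : ∀ ρ → IsSupport restrictions ρ (image< ρ)
restriction-isSupport ρ = record
  { stable    = λ _ → decidable-stable (_ ≟ʰ below)
  ; supports  = λ π fix c c< →
      trans (++-⟨$⟩ π ρ c) (fix (subst 𝔸< (sym (reverse-inverseˡ ρ c)) c<))
  ; permitted = permitted-perm (reverse ρ) (lower , 𝔸<⊆lower)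
  ; least     = λ st sup (S , A′⊆S) {c} c∈ → st c λ c∉ → moved sup S A′⊆S c c∈ c∉
  }
  where
  moved : ∀ {A′} → Supports restrictions A′ ρ → ∀ S → A′ ⊆ ⌊ S ⌋ →
          ∀ c → c ∈ image< ρ → c ∉ A′ → ⊥
  moved sup S A′⊆S c c∈ c∉ with upper-fresh (sort c) S c
  ... | n , e∉ , e≢c = e≢c (trans (sym (swap-left c e)) fixed)
    where
    e : Atom
    e = atom (sort c) above n

    fixed : swap c e c ≡ c
    fixed = subst (λ d → swap c e d ≡ d) (reverse-inverseʳ ρ c)
      (sup [ swapping c e refl ] (swap-fixes-⊆ c∉ (e∉ ∘ A′⊆S)) _ c∈)

restrictionsₙ : PermissiveNominalSet
restrictionsₙ = record
  { permSet   = restrictions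
  ; supp      = image<
  ; isSupport = restriction-isSupport
  }

-- The atoms that occur in a word of swappings.
mentioned : Perm → List Atom
mentioned []                    = []
mentioned (swapping a b _ ∷ ρ) = a ∷ b ∷ mentioned ρ

unmentioned-fixed : ∀ ρ {c} → c ∉ₗ mentioned ρ → ρ ⟨$⟩ c ≡ c
unmentioned-fixed []                    _  = refl
unmentioned-fixed (swapping a b _ ∷ ρ) c∉ =
  trans (cong (swap a b) (unmentioned-fixed ρ (c∉ ∘ there ∘ there)))
    (swap-fixes (c∉ ∘ here) (c∉ ∘ there ∘ here))

-- Two permutations can differ only at the atoms that one of them mentions.
_≈<?_ : ∀ ρ σ → Dec (ρ ≈< σ)
ρ ≈<? σ = map′ extend (λ p → tabulate λ {c} _ → p c) (all? agree? atoms)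
  where
  atoms : List Atom
  atoms = mentioned ρ ++ mentioned σ

  Agree : Pred Atom 0ℓ
  Agree c = c ∈ 𝔸< → ρ ⟨$⟩ c ≡ σ ⟨$⟩ c

  agree? : ∀ c → Dec (Agree c)
  agree? c = (half c ≟ʰ below) →-dec ((ρ ⟨$⟩ c) ≟ (σ ⟨$⟩ c))

  extend : All Agree atoms → ρ ≈< σ
  extend agree c with any? (c ≟_) atoms
  ... | yes c∈ = lookup agree c∈
  ... | no c∉  = λ _ → trans (unmentioned-fixed ρ (c∉ ∘ ∈-++⁺ˡ))
                         (sym (unmentioned-fixed σ (c∉ ∘ ∈-++⁺ʳ (mentioned ρ))))

-- The booleans with the trivial action.
booleans : PermSet
booleans = record
  { setoid = setoid Bool
  ; _·_    = λ _ x → x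
  ; ·-cong = λ _ p → p
  ; ·-id   = λ _ → refl
  ; ·-∘    = λ _ _ _ → refl
  }

booleansₙ : PermissiveNominalSet
booleansₙ = record
  { permSet   = booleans
  ; supp      = λ _ → ∅
  ; isSupport = λ _ → invariant-isSupport booleans λ _ → refl
  }

-- Signature and axioms

-- The sort of the constant  point  and that of the results of comparisons.
data Base : Set where
  points truths : Base

data Constants : Set where
  point falsity : Constants

-- The only term-former is  equal.  No unknowns are needed.
sig : Signature
sig = record
  { NameSort   = ∅
  ; BaseSort   = Base
  ; Constant   = Constants
  ; sortC      = λ { point → points ; falsity → truths }
  ; pmss       = λ { point → 𝔸< ; falsity → ∅ }
  ; pmss⊆<     = λ { point → id ; falsity () }
  ; Unknown    = ⊥
  ; sortX      = λ ()
  ; fa         = λ ()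
  ; TermFormer = ⊤
  ; argument   = λ _ → tup (base points ∷ base points ∷ [])
  ; result     = λ _ → truths
  }

open Signature sig using (Sorts)

low : ℕ → Atom
low = atom 0 below

swapLow : ℕ → ℕ → Perm
swapLow m n = [ swapping (low m) (low n) refl ]

-- The term  equal(point, π·point).
equalsImage : Perm → Term sig (base truths)
equalsImage π = app tt (tup (con [] point ∷ con π point ∷ []))

falsityTerm : Term sig (base truths)
falsityTerm = con [] falsity

-- The axioms  equal(point, (a b)·point) = falsity  for distinct lower atoms a
-- and b of sort 0.
data Axioms : ∀ {α} → Term sig α → Term sig α → Set where
  moves : ∀ {m n} → m ≢ n → Axioms (equalsImage (swapLow m n)) falsityTerm

theory : Theory
theory = record { signature = sig ; Axiom = Axioms }

-- Models with finite support

entails-fin : Entails-fin theory (equalsImage []) falsityTerm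
entails-fin I fin models ς with fin (base points) (Interpretation.conᴵ I point)
... | as , supp⊆as with fresh 0 below as
... | m , m∉ with fresh 0 below (low m ∷ as)
... | n , n∉ = ⟦truths⟧.≈-trans
    (Equivariant.to-cong (I.appᴵ tt)
      (EquivariantInjection.to-cong (I.tupᴵ (base points ∷ base points ∷ []))
        (⟦points⟧.≈-refl , unmoved , refl)))
    (models (moves {m} {n} (λ m≡n → n∉ (here (cong low (sym m≡n))))) ς)
  where
  module I = Interpretation I
  module ⟦points⟧ = PermissiveNominalSet (I.⟦ base points ⟧)
  module ⟦truths⟧ = PermissiveNominalSet (I.⟦ base truths ⟧)

  p : ⟦points⟧.Carrier
  p = I.conᴵ point

  unmoved : ([] ⟦points⟧.· p) ⟦points⟧.≈ (swapLow m n ⟦points⟧.· p)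
  unmoved = ⟦points⟧.≈-trans (⟦points⟧.·-id p)
    (⟦points⟧.≈-sym (IsSupport.supports (⟦points⟧.isSupport p) (swapLow m n)
      (swap-fixes-⊆ {A = ⟦points⟧.supp p} (m∉ ∘ supp⊆as) (n∉ ∘ there ∘ supp⊆as))))

-- A model with infinite support

-- Without name sorts there are only base sorts and tuple sorts to interpret.
⟦_⟧ˢ  : Sorts → PermissiveNominalSet
⟦_⟧ˢˢ : List Sorts → List PermissiveNominalSet

⟦ base points ⟧ˢ = restrictionsₙ
⟦ base truths ⟧ˢ = booleansₙ
⟦ tup αs ⟧ˢ      = ∏ₙ ⟦ αs ⟧ˢˢ

⟦ [] ⟧ˢˢ     = []
⟦ α ∷ αs ⟧ˢˢ = ⟦ α ⟧ˢ ∷ ⟦ αs ⟧ˢˢ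

⟦⟧ˢˢ-map : ∀ αs → map permSet ⟦ αs ⟧ˢˢ ≡ map (permSet ∘ ⟦_⟧ˢ) αs
⟦⟧ˢˢ-map []       = refl
⟦⟧ˢˢ-map (α ∷ αs) = cong (permSet ⟦ α ⟧ˢ ∷_) (⟦⟧ˢˢ-map αs)

identity : ∀ X → EquivariantInjection X X
identity X = record
  { equivariantMap = record
    { to          = id
    ; to-cong     = id
    ; equivariant = λ _ _ → PermSet.≈-refl X
    }
  ; injective = id
  }

-- Deciding equality is equivariant, because permutations act injectively.
equality : Equivariant (permSet ⟦ tup (base points ∷ base points ∷ []) ⟧ˢ) booleans
equality = record
  { to          = λ (ρ , σ , _) → does (ρ ≈<? σ)
  ; to-cong     = λ {(ρ , σ , _)} {(ρ′ , σ′ , _)} (p , q , _) → does-⇔ (mk⇔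
      (λ r c c< → trans (sym (p c c<)) (trans (r c c<) (q c c<)))
      (λ r c c< → trans (p c c<) (trans (r c c<) (sym (q c c<)))))
      (ρ ≈<? σ) (ρ′ ≈<? σ′)
  ; equivariant = λ π (ρ , σ , _) → does-⇔ (mk⇔
      (λ r c c< → ⟨$⟩-injective π
        (trans (sym (++-⟨$⟩ π ρ c)) (trans (r c c<) (++-⟨$⟩ π σ c))))
      (λ r c c< → trans (++-⟨$⟩ π ρ c)
        (trans (cong (π ⟨$⟩_) (r c c<)) (sym (++-⟨$⟩ π σ c)))))
      ((π ++ ρ) ≈<? (π ++ σ)) (ρ ≈<? σ)
  }

-- The constant  point  is the restriction of the identity, which is the empty
-- word.  The maps on tuples are identities: the transport only rearranges how
-- the list of factors is computed.
model : Interpretation sig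
model = record
  { ⟦_⟧   = ⟦_⟧ˢ
  ; atmᴵ  = λ _ ()
  ; absᴵ  = λ _ ()
  ; tupᴵ  = λ αs →
      subst (λ Xs → EquivariantInjection (∏ Xs) (permSet ⟦ tup αs ⟧ˢ)) (⟦⟧ˢˢ-map αs)
        (identity (permSet ⟦ tup αs ⟧ˢ))
  ; appᴵ  = λ _ → equality
  ; conᴵ  = λ { point → [] ; falsity → false }
  ; conᴵ⊆ = λ { point → id ; falsity () }
  }

models-model : Models theory model
models-model (moves {m} {n} m≢n) _ = dec-false ([] ≈<? swapLow m n) λ same →
  m≢n (cong index (trans (same (low m) refl) (swap-left (low m) (low n))))

not-entails : ¬ Entails theory (equalsImage []) falsityTerm
not-entails entails = contradiction
  (trans (sym (dec-true ([] ≈<? []) λ _ _ → refl))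
    (entails model models-model record { val = λ () ; val⊆ = λ () }))
  λ ()

proposition8p2 : Σ[ T ∈ Theory ] ∃[ α ] Σ[ r ∈ Term (Theory.signature T) α ] Σ[ s ∈ Term (Theory.signature T) α ]
    (Entails-fin T r s × ¬ (Entails T r s))
proposition8p2 = theory , base truths , equalsImage [] , falsityTerm , entails-fin , not-entails
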